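{- Let $G$ be a finite graph with vertex set $V$, whose vertices are labeled and whose edges are unlabeled. The vertex labeled minors of $G$ which are simple graphs are in bijection with the minors of the minimally generated lattice of flats $L(G)$, via the map $H\mapsto L(H)$.
   Context: Graphs may have loops and multiple edges; a graph is simple if it has neither. For a graph $\Gamma$ whose vertices are labeled by the blocks of a partition of $V$ (so $V(\Gamma)$ is a set partition of $V$), and a set $A$ of edges of $\Gamma$, let $\pi(A)$ be the partition of $V$ whose blocks are the unions of the labels of the vertices in each connected component of the spanning subgraph $(V(\Gamma),A)$. The lattice $K$ of all such partitions $\pi(A)$, $A\subseteq E(\Gamma)$, ordered by refinement (these correspond to the flats of the graphic matroid of $\Gamma$), together with its set $\operatorname{irr}(K)$ of join irreducibles, is the generator enriched lattice $L(\Gamma)=(K,\operatorname{irr}(K))$. The original graph $G$ is labeled by singletons $\{v\}$, $v\in V$. Vertex labeled minors: deleting an edge removes it; contracting a non-loop edge with endpoints labeled $B_1,B_2$ identifies its endpoints into one vertex labeled $B_1\cup B_2$ (contracting a loop removes it); a vertex labeled minor of $G$ is any vertex labeled graph obtained from $G$ by a finite sequence of edge deletions and contractions (no vertex deletions). Two vertex labeled graphs are considered equal if they have the same labeled vertices and the same edges between labeled vertices (edges are unlabeled). A generator enriched lattice is a pair $(L,G')$ with $L$ a finite lattice and $G'\subseteq L\setminus\{\widehat0\}$ generating $L$ under joins. For $H\subseteq L$ and $z<h$ for all $h\in H$, $\langle H|z\rangle=(\{z\}\cup\{\bigvee_{x\in S}x:\emptyset\ne S\subseteq H\},H)$. For $I\subseteq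 G'$: deletion $(L,G')\setminus I=\langle G'\setminus I|\widehat0_L\rangle$; with $i_0=\bigvee I$ and $J=\{g\vee i_0:g\in G'\}\setminus\{i_0\}$, contraction $(L,G')/I=\langle J|i_0\rangle$. A minor is the result of any finite sequence of deletions and contractions. Minors of $L(G)$ are thus generator enriched lattices whose elements are partitions of $V$. -}

module Defs where

open import Data.Nat using (ℕ; zero; suc; _≤_)
open import Data.Bool using (Bool; true; false; _∧_; _∨_; not; if_then_else_)
import Data.Bool as B
open import Data.Fin using (Fin)
import Data.Fin as F
open import Data.Vec using (Vec; tabulate; replicate)
import Data.Vec as V
import Data.Vec.Properties as VP
open import Data.List using (List; []; _∷_; _++_; map; foldr; concatMap; filterᵇ; length; removeAt; allFin)
open import Data.Bool.ListAction using (any; all)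
import Data.List as L
open import Data.List.Membership.Propositional using (_∈_)
open import Data.List.Relation.Unary.All using (All)
open import Data.Product using (Σ; _×_; _,_; proj₁; proj₂)
open import Relation.Nullary.Decidable using (isYes)
open import Relation.Binary.PropositionalEquality using (_≡_)

-- Partitions of V = Fin n, represented canonically by the Boolean
-- matrix of their equivalence relation ("x and y lie in the same block").
-- Equality of partitions is therefore plain _≡_.

Part : ℕ → Set
Part n = Vec (Vec Bool n) n

rel : ∀ {n} → Part n → Fin n → Fin n → Bool
rel P x y = V.lookup (V.lookup P x) y

eqF : ∀ {n} → Fin n → Fin n → Bool
eqF x y = isYes (x F.≟ y)

_==P_ : ∀ {n} → Part n → Part n → Bool
P ==P Q = isYes (VP.≡-dec (VP.≡-dec B._≟_) P Q)

_∈ᵇ_ : ∀ {n} → Part n → List (Part n) → Bool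
P ∈ᵇ Qs = any (P ==P_) Qs

anyF : ∀ {n} → (Fin n → Bool) → Bool
anyF {n} f = any f (allFin n)

reach : ∀ {n} → (Fin n → Fin n → Bool) → ℕ → Fin n → Fin n → Bool
reach r zero    x y = eqF x y
reach r (suc k) x y = reach r k x y ∨ anyF (λ z → reach r k x z ∧ r z y)

-- the partition of V into connected components of the (symmetric) relation r
-- (walks of length ≤ n suffice)
closure : ∀ {n} → (Fin n → Fin n → Bool) → Part n
closure {n} r = tabulate λ x → tabulate λ y → reach r n x y

discrete : ∀ {n} → Part n
discrete = tabulate λ x → tabulate λ y → eqF x y

top : ∀ {n} → Part n
top = replicate _ (replicate _ true)

_⊔_ : ∀ {n} → Part n → Part n → Part n
P ⊔ Q = closure (λ x y → rel P x y ∨ rel Q x y)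

_⊓_ : ∀ {n} → Part n → Part n → Part n
P ⊓ Q = tabulate λ x → tabulate λ y → rel P x y ∧ rel Q x y

-- Vertex labeled graphs.  The vertices are the blocks of the partition
-- 'verts'; an edge (a , b) (a, b ∈ V) joins the block of a and the block
-- of b (a loop if they coincide).  Edges form a multiset (a list).

record LGraph (n : ℕ) : Set where
  constructor lgraph
  field
    verts : Part n
    edges : List (Fin n × Fin n)
open LGraph public

joinsB : ∀ {n} → Part n → Fin n × Fin n → Fin n → Fin n → Bool
joinsB P (a , b) x y = (rel P a x ∧ rel P b y) ∨ (rel P a y ∧ rel P b x)

mult : ∀ {n} → LGraph n → Fin n → Fin n → ℕ
mult Γ x y = length (filterᵇ (λ e → joinsB (verts Γ) e x y) (edges Γ))

_≈G_ : ∀ {n} → LGraph n → LGraph n → Set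
Γ ≈G Δ = (verts Γ ≡ verts Δ) × (∀ x y → mult Γ x y ≡ mult Δ x y)

Simple : ∀ {n} → LGraph n → Set
Simple Γ = (∀ e → e ∈ edges Γ → rel (verts Γ) (proj₁ e) (proj₂ e) ≡ false)
         × (∀ x y → mult Γ x y ≤ 1)

orig : ∀ {n} → List (Fin n × Fin n) → LGraph n
orig E = lgraph discrete E

merge : ∀ {n} → Part n → Fin n → Fin n → Part n
merge P a b = closure (λ x y → rel P x y ∨ (eqF x a ∧ eqF y b) ∨ (eqF x b ∧ eqF y a))

deleteE : ∀ {n} → (Γ : LGraph n) → Fin (length (edges Γ)) → LGraph n
deleteE Γ i = lgraph (verts Γ) (removeAt (edges Γ) i)

contractE : ∀ {n} → (Γ : LGraph n) → Fin (length (edges Γ)) → LGraph n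
contractE Γ i with L.lookup (edges Γ) i
... | (a , b) = lgraph (if rel (verts Γ) a b then verts Γ else merge (verts Γ) a b)
                       (removeAt (edges Γ) i)

data Derives {n} (Γ : LGraph n) : LGraph n → Set where
  here : Derives Γ Γ
  del  : ∀ {Δ} → Derives Γ Δ → (i : Fin (length (edges Δ))) → Derives Γ (deleteE Δ i)
  con  : ∀ {Δ} → Derives Γ Δ → (i : Fin (length (edges Δ))) → Derives Γ (contractE Δ i)

VLMinor : ∀ {n} → LGraph n → LGraph n → Set
VLMinor Γ H = Σ (LGraph _) λ Δ → Derives Γ Δ × (Δ ≈G H)

-- Generator enriched lattices whose elements are partitions of V.

record GEL (n : ℕ) : Set where
  constructor gel
  field
    carrier : List (Part n)
    gens    : List (Part n)
open GEL public

SetEq : ∀ {n} → List (Part n) → List (Part n) → Set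
SetEq xs ys = (∀ x → x ∈ xs → x ∈ ys) × (∀ x → x ∈ ys → x ∈ xs)

_≈L_ : ∀ {n} → GEL n → GEL n → Set
M ≈L N = SetEq (carrier M) (carrier N) × SetEq (gens M) (gens N)

subs : ∀ {A : Set} → List A → List (List A)
subs []       = [] ∷ []
subs (x ∷ xs) = subs xs ++ map (x ∷_) (subs xs)

neJoin : ∀ {n} → List (Part n) → List (Part n)
neJoin []       = []
neJoin (x ∷ xs) = foldr _⊔_ x xs ∷ []

angle : ∀ {n} → List (Part n) → Part n → GEL n
angle H z = gel (z ∷ concatMap neJoin (subs H)) H

botL : ∀ {n} → GEL n → Part n
botL M = foldr _⊓_ top (carrier M)

deletionL : ∀ {n} → GEL n → List (Part n) → GEL n
deletionL M I = angle (filterᵇ (λ g → not (g ∈ᵇ I)) (gens M)) (botL M)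

contractionL : ∀ {n} → GEL n → List (Part n) → GEL n
contractionL M I =
  let i₀ = foldr _⊔_ (botL M) I
  in angle (filterᵇ (λ g → not (g ==P i₀)) (map (_⊔ i₀) (gens M))) i₀

data DerivesL {n} (M : GEL n) : GEL n → Set where
  here : DerivesL M M
  del  : ∀ {N} → DerivesL M N → (I : List (Part n)) → All (_∈ gens N) I →
         DerivesL M (deletionL N I)
  con  : ∀ {N} → DerivesL M N → (I : List (Part n)) → All (_∈ gens N) I →
         DerivesL M (contractionL N I)

GELMinor : ∀ {n} → GEL n → GEL n → Set
GELMinor M N = Σ (GEL _) λ N' → DerivesL M N' × (N' ≈L N)

-- π(A): blocks are unions of labels over connected components of (V(Γ), A)
piOf : ∀ {n} → Part n → List (Fin n × Fin n) → Part n
piOf P A = closure (λ x y → rel P x y ∨ any (λ e → joinsB P e x y) A)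

flats : ∀ {n} → LGraph n → List (Part n)
flats Γ = map (piOf (verts Γ)) (subs (edges Γ))

isIrr : ∀ {n} → List (Part n) → Part n → Bool
isIrr K x = not (x ==P foldr _⊓_ top K)
          ∧ all (λ a → all (λ b → not ((a ⊔ b) ==P x) ∨ (a ==P x) ∨ (b ==P x)) K) K

irr : ∀ {n} → List (Part n) → List (Part n)
irr K = filterᵇ (isIrr K) K

Lat : ∀ {n} → LGraph n → GEL n
Lat Γ = gel (flats Γ) (irr (flats Γ))

{-# OPTIONS --safe #-}
module Submission where

-- The partitions in L(Γ) are the joins of the atoms π({e}), e a non-loop, over the partition of vertices,
-- and the join irreducibles are exactly these atoms.  Deleting edges deletes their atoms, and contracting
-- edges with join i₀ turns an atom g into g ∨ i₀, with the atoms below i₀ becoming loops; so both kinds of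
-- minors correspond step by step, once loops and parallel edges, which L(Γ) does not see, are ignored.
-- Removing those makes a minor simple.  A simple graph is recovered from its lattice: the bottom gives the
-- vertices, and the atom of a non-loop e determines the pair of blocks joined by e.

open import Defs
open import Data.Nat using (ℕ; zero; suc; _≤_; _<_; z≤n; s≤s)
open import Data.Nat.Properties using (≤-trans; ≤-reflexive; n≮n; ≮⇒≥)
open import Data.Bool using (Bool; true; false; T; not; _∧_; _∨_; if_then_else_)
open import Data.Bool.Properties using (T?; T-∧; T-∨; T-≡; T-not-≡)
open import Data.Bool.ListAction using (any)
open import Data.Fin using (Fin; zero; suc)
import Data.Fin.Properties as FP
open import Data.Fin.Subset using (Subset; ∣_∣; ⁅_⁆)
import Data.Fin.Subset as FS
open import Data.Fin.Subset.Properties using (∣p∣≤n; p⊂q⇒∣p∣<∣q∣; p⊆q⇒∣p∣≤∣q∣; ∣⁅x⁆∣≡1; x∈⁅y⁆⇒x≡y)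
import Data.Vec as V
import Data.Vec.Properties as VP
open import Data.List using (List; []; _∷_; _++_; map; foldr; filter; filterᵇ; length; removeAt; allFin; lookup)
open import Data.List.Properties using (++-assoc)
open import Data.List.Membership.Propositional using (_∈_; _∉_; lose; find)
open import Data.List.Membership.Propositional.Properties
  using (∈-map⁺; ∈-map⁻; ∈-++⁺ˡ; ∈-++⁺ʳ; ∈-++⁻; ∈-concatMap⁺; ∈-concatMap⁻; ∈-filter⁺; ∈-filter⁻; ∈-allFin; ∈-lookup)
open import Data.List.Relation.Unary.Any as Any using (here; there)
open import Data.List.Relation.Unary.Any.Properties using (any⁺; any⁻; lookup-index)
open import Data.List.Relation.Unary.All as All using (All; []; _∷_)
open import Data.List.Relation.Unary.All.Properties using (all⁺; all⁻)
open import Data.List.Relation.Binary.Sublist.Propositional using (_⊆_; []; _∷_; _∷ʳ_; ⊆-refl; ⊆-trans)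
import Data.List.Relation.Binary.Sublist.Propositional as Sublist
open import Data.List.Relation.Binary.Sublist.Propositional.Properties using (filter-⊆)
open import Data.Product using (Σ; ∃; _×_; _,_; proj₁; proj₂)
open import Data.Sum using (_⊎_; inj₁; inj₂; [_,_]′)
open import Data.Empty using (⊥-elim)
open import Function using (_∘_; id)
open import Function.Bundles using (_⇔_; mk⇔; Equivalence)
open import Relation.Nullary using (¬_; Dec; yes; no; contradiction)
open import Relation.Nullary.Decidable using (toWitness; fromWitness; ¬?; _×-dec_; map′; decidable-stable)
open import Relation.Binary.Structures using (IsEquivalence)
open import Relation.Binary.PropositionalEquality using (_≡_; _≢_; refl; sym; trans; cong; subst)

open Equivalence using (to; from)

-- The steps on the two sides do not match one to one. Deleting an edge that has a parallel copy
-- loses no atom, contracting a loop changes nothing in the lattice, and one lattice contraction can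
-- absorb many edges, some of which become loops before their turn comes. Both inductions therefore
-- carry the relation `Represents`, which sees a graph only through its vertex partition and its set
-- of atoms, and simplicity is imposed once, at the end. Since `Part` admits arbitrary Boolean
-- matrices, validity of the vertex partition accompanies every derivation.

private variable
  n : ℕ

-- Booleans and lists

T-ext : ∀ {a b} → (T a → T b) → (T b → T a) → a ≡ b
T-ext {true}  {true}  f g = refl
T-ext {true}  {false} f g = ⊥-elim (f _)
T-ext {false} {true}  f g = ⊥-elim (g _)
T-ext {false} {false} f g = refl

T-not⁺ : ∀ {a} → ¬ T a → T (not a)
T-not⁺ {true}  ¬a = ⊥-elim (¬a _)
T-not⁺ {false} ¬a = _

T-not⁻ : ∀ {a} → T (not a) → ¬ T a
T-not⁻ {false} _ ()

∈-filterᵇ⁺ : ∀ {A : Set} (p : A → Bool) {x xs} → x ∈ xs → T (p x) → x ∈ filterᵇ p xs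
∈-filterᵇ⁺ p = ∈-filter⁺ (T? ∘ p)

∈-filterᵇ⁻ : ∀ {A : Set} (p : A → Bool) {x xs} → x ∈ filterᵇ p xs → x ∈ xs × T (p x)
∈-filterᵇ⁻ p {xs = xs} = ∈-filter⁻ (T? ∘ p) {xs = xs}

∈-subs⁺ : ∀ {A : Set} {xs ys : List A} → xs ⊆ ys → xs ∈ subs ys
∈-subs⁺ []                         = here refl
∈-subs⁺ (y ∷ʳ p)                   = ∈-++⁺ˡ (∈-subs⁺ p)
∈-subs⁺ {ys = _ ∷ ys} (refl ∷ p) = ∈-++⁺ʳ (subs ys) (∈-map⁺ _ (∈-subs⁺ p))

∈-subs⁻ : ∀ {A : Set} {xs} (ys : List A) → xs ∈ subs ys → xs ⊆ ys
∈-subs⁻ [] (here refl) = []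
∈-subs⁻ (y ∷ ys) p with ∈-++⁻ (subs ys) p
... | inj₁ q = y ∷ʳ ∈-subs⁻ ys q
... | inj₂ q with ∈-map⁻ _ q
...   | zs , zs∈ , refl = refl ∷ ∈-subs⁻ ys zs∈

∈-removeAt : ∀ {A : Set} {x : A} xs i → x ∈ xs → x ∈ removeAt xs i ⊎ x ≡ lookup xs i
∈-removeAt (y ∷ xs) zero    (here eq) = inj₂ eq
∈-removeAt (y ∷ xs) zero    (there m) = inj₁ m
∈-removeAt (y ∷ xs) (suc i) (here eq) = inj₁ (here eq)
∈-removeAt (y ∷ xs) (suc i) (there m) with ∈-removeAt xs i m
... | inj₁ q = inj₁ (there q)
... | inj₂ q = inj₂ q

removeAt-⊆ : ∀ {A : Set} (xs : List A) i → removeAt xs i ⊆ xs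
removeAt-⊆ (x ∷ xs) zero    = x ∷ʳ ⊆-refl
removeAt-⊆ (x ∷ xs) (suc i) = refl ∷ removeAt-⊆ xs i

removeAt-++ : ∀ {A : Set} (xs : List A) y ys → ∃ λ i → removeAt (xs ++ y ∷ ys) i ≡ xs ++ ys
removeAt-++ []       y ys = zero , refl
removeAt-++ (x ∷ xs) y ys with removeAt-++ xs y ys
... | i , eq = suc i , cong (x ∷_) eq

0<length⇒∃ : ∀ {A : Set} {xs : List A} → 0 < length xs → ∃ (_∈ xs)
0<length⇒∃ {xs = x ∷ _} _ = x , here refl

∈⇒0<length : ∀ {A : Set} {x : A} {xs} → x ∈ xs → 0 < length xs
∈⇒0<length (here _)  = s≤s z≤n
∈⇒0<length (there _) = s≤s z≤n

-- Meant for simple graphs: multiplicities bounded by 1 are determined by whether they are positive.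
≤1-ext : ∀ {a b} → a ≤ 1 → b ≤ 1 → (0 < a → 0 < b) → (0 < b → 0 < a) → a ≡ b
≤1-ext {zero}  {zero}  _         _         f g = refl
≤1-ext {zero}  {suc b} _         _         f g with () ← g (s≤s z≤n)
≤1-ext {suc a} {zero}  _         _         f g with () ← f (s≤s z≤n)
≤1-ext {suc .0} {suc .0} (s≤s z≤n) (s≤s z≤n) f g = refl

-- Partitions

-- A record rather than a synonym, so that P, x and y can be inferred.
record _⊢_∼_ {n} (P : Part n) (x y : Fin n) : Set where
  constructor ⟨_⟩
  field holds : T (rel P x y)
open _⊢_∼_

_⊢_∼?_ : ∀ (P : Part n) x y → Dec (P ⊢ x ∼ y)
P ⊢ x ∼? y = map′ ⟨_⟩ holds (T? _)

-- A `Part` is just a Boolean matrix; this predicate singles out the genuine partitions.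
Valid : Part n → Set
Valid P = IsEquivalence (P ⊢_∼_)

module Equiv {n} {P : Part n} (v : Valid P) where
  open IsEquivalence v public renaming (refl to ∼-refl; sym to ∼-sym; trans to ∼-trans)
open Equiv

infix 4 _⊢_∼_ _⊢_∼?_ _⊑_

_⊑_ : Part n → Part n → Set
P ⊑ Q = ∀ {x y} → P ⊢ x ∼ y → Q ⊢ x ∼ y

⊑-antisym : {P Q : Part n} → P ⊑ Q → Q ⊑ P → P ≡ Q
⊑-antisym {P = P} {Q} p q = lookup-ext λ x → lookup-ext λ y →
    T-ext (λ t → holds (p ⟨ t ⟩)) (λ t → holds (q ⟨ t ⟩))
  where
  lookup-ext : ∀ {A : Set} {m} {u w : V.Vec A m} → (∀ i → V.lookup u i ≡ V.lookup w i) → u ≡ w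
  lookup-ext {u = u} {w} eq =
    trans (sym (VP.tabulate∘lookup u)) (trans (VP.tabulate-cong eq) (VP.tabulate∘lookup w))

≡⇒⊑ : {P Q : Part n} → P ≡ Q → P ⊑ Q
≡⇒⊑ refl = id

rel-tabulate : ∀ (f : Fin n → Fin n → Bool) x y → rel (V.tabulate λ x → V.tabulate (f x)) x y ≡ f x y
rel-tabulate f x y =
  trans (cong (λ row → V.lookup row y) (VP.lookup∘tabulate (λ x → V.tabulate (f x)) x)) (VP.lookup∘tabulate (f x) y)

tabulate⁺ : ∀ (f : Fin n → Fin n → Bool) {x y} → T (f x y) → V.tabulate (λ x → V.tabulate (f x)) ⊢ x ∼ y
tabulate⁺ f {x} {y} t = ⟨ subst T (sym (rel-tabulate f x y)) t ⟩

tabulate⁻ : ∀ (f : Fin n → Fin n → Bool) {x y} → V.tabulate (λ x → V.tabulate (f x)) ⊢ x ∼ y → T (f x y)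
tabulate⁻ f {x} {y} t = subst T (rel-tabulate f x y) (holds t)

discrete-valid : Valid (discrete {n})
discrete-valid = record
  { refl  = tabulate⁺ eqF (fromWitness refl)
  ; sym   = λ p → tabulate⁺ eqF (fromWitness (sym (eq p)))
  ; trans = λ p q → tabulate⁺ eqF (fromWitness (trans (eq p) (eq q)))
  }
  where
  eq : ∀ {x y} → discrete ⊢ x ∼ y → x ≡ y
  eq p = toWitness (tabulate⁻ eqF p)

-- Connected components

module Reach {n} (r : Fin n → Fin n → Bool) where

  reach-weaken : ∀ k {x y} → T (reach r k x y) → T (reach r (suc k) x y)
  reach-weaken k t = from T-∨ (inj₁ t)

  reach-step : ∀ k {x y} z → T (reach r k x z) → T (r z y) → T (reach r (suc k) x y)
  reach-step k {x} {y} z t s = from (T-∨ {reach r k x y})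
    (inj₂ (any⁺ _ (lose (∈-allFin z) (from T-∧ (t , s)))))

  reach-suc⁻ : ∀ k {x y} → T (reach r (suc k) x y) →
               T (reach r k x y) ⊎ ∃ λ z → T (reach r k x z) × T (r z y)
  reach-suc⁻ k t with to T-∨ t
  ... | inj₁ s = inj₁ s
  ... | inj₂ s with find (any⁻ _ (allFin n) s)
  ...   | z , _ , q = inj₂ (z , to T-∧ q)

  reach-refl : ∀ k {x} → T (reach r k x x)
  reach-refl zero    = fromWitness refl
  reach-refl (suc k) = reach-weaken k (reach-refl k)

  Stable : ℕ → Fin n → Set
  Stable k x = ∀ y → T (reach r (suc k) x y) → T (reach r k x y)

  stable-suc : ∀ k {x} → Stable k x → Stable (suc k) x
  stable-suc k st y t with reach-suc⁻ (suc k) t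
  ... | inj₁ s           = s
  ... | inj₂ (z , s , q) = reach-step k z (st z s) q

  ball : ℕ → Fin n → Subset n
  ball k x = V.tabulate (reach r k x)

  ∈-ball⁺ : ∀ k {x y} → T (reach r k x y) → y FS.∈ ball k x
  ∈-ball⁺ k t = VP.lookup⇒[]= _ _ (trans (VP.lookup∘tabulate (reach r k _) _) (to T-≡ t))

  ∈-ball⁻ : ∀ k {x y} → y FS.∈ ball k x → T (reach r k x y)
  ∈-ball⁻ k m = from T-≡ (trans (sym (VP.lookup∘tabulate (reach r k _) _)) (VP.[]=⇒lookup m))

  -- As long as the balls around x have not stabilised, each contains a new point.
  ball-growth : ∀ k x → suc k ≤ ∣ ball k x ∣ ⊎ Stable k x
  ball-growth zero x = inj₁ (≤-trans (≤-reflexive (sym (∣⁅x⁆∣≡1 x))) (p⊆q⇒∣p∣≤∣q∣ singleton))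
    where
    singleton : ⁅ x ⁆ FS.⊆ ball 0 x
    singleton m with refl ← x∈⁅y⁆⇒x≡y x m = ∈-ball⁺ 0 {x} (reach-refl 0 {x})
  ball-growth (suc k) x with ball-growth k x
  ... | inj₂ st = inj₂ (stable-suc k st)
  ... | inj₁ le with FP.any? (λ y → T? (reach r (suc k) x y) ×-dec ¬? (T? (reach r k x y)))
  ...   | yes (y , t , ¬t) = inj₁ (≤-trans (s≤s le) (p⊂q⇒∣p∣<∣q∣
            ( (λ m → ∈-ball⁺ (suc k) {x} (reach-weaken k (∈-ball⁻ k m)))
            , y , ∈-ball⁺ (suc k) {x} t , ¬t ∘ ∈-ball⁻ k)))
  ...   | no none = inj₂ (stable-suc k λ y t →
            decidable-stable (T? _) λ ¬t → none (y , t , ¬t))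

  -- The growing alternative of `ball-growth` at `n` would put more than `n` points into a subset of
  -- `Fin n`. This is why walks of length `n` suffice in `closure`.
  stable : ∀ x → Stable n x
  stable x with ball-growth n x
  ... | inj₁ le = contradiction (≤-trans le (∣p∣≤n (ball n x))) (n≮n n)
  ... | inj₂ st = st

  closure⁺ : ∀ {x y} → T (reach r n x y) → closure r ⊢ x ∼ y
  closure⁺ = tabulate⁺ (reach r n)

  closure⁻ : ∀ {x y} → closure r ⊢ x ∼ y → T (reach r n x y)
  closure⁻ = tabulate⁻ (reach r n)

  -- One more step makes a walk of length `n + 1`, which `stable` shortens again. Inclusion,
  -- transitivity and symmetry of `closure` all go back to this.
  closure-extend : ∀ {x y z} → closure r ⊢ x ∼ z → T (r z y) → closure r ⊢ x ∼ y
  closure-extend {x} {y} {z} p t = closure⁺ (stable x y (reach-step n z (closure⁻ p) t))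

  closure-refl : ∀ {x} → closure r ⊢ x ∼ x
  closure-refl = closure⁺ (reach-refl n)

  closure-incl : ∀ {x y} → T (r x y) → closure r ⊢ x ∼ y
  closure-incl = closure-extend closure-refl

  reach-least : ∀ (R : Fin n → Fin n → Set) → IsEquivalence R → (∀ {x y} → T (r x y) → R x y) →
                ∀ k {x y} → T (reach r k x y) → R x y
  reach-least R e h zero    t rewrite toWitness t = IsEquivalence.refl e
  reach-least R e h (suc k) t with reach-suc⁻ k t
  ... | inj₁ s           = reach-least R e h k s
  ... | inj₂ (z , s , q) = IsEquivalence.trans e (reach-least R e h k s) (h q)

  -- `R` is a relation and not a `Part`, so that `linked-atom` can apply this to a relation
  -- described by a formula.
  closure-least : ∀ {R : Fin n → Fin n → Set} → IsEquivalence R → (∀ {x y} → T (r x y) → R x y) →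
                  ∀ {x y} → closure r ⊢ x ∼ y → R x y
  closure-least e h = reach-least _ e h n ∘ closure⁻

  closure-trans : ∀ {x y z} → closure r ⊢ x ∼ y → closure r ⊢ y ∼ z → closure r ⊢ x ∼ z
  closure-trans {x} {y} p = go n ∘ closure⁻
    where
    go : ∀ k {z} → T (reach r k y z) → closure r ⊢ x ∼ z
    go zero    t = subst (closure r ⊢ x ∼_) (toWitness t) p
    go (suc k) t with reach-suc⁻ k t
    ... | inj₁ s           = go k s
    ... | inj₂ (_ , s , q) = closure-extend (go k s) q

  closure-valid : (∀ x y → T (r x y) → T (r y x)) → Valid (closure r)
  closure-valid r-sym = record { refl = closure-refl ; sym = go n ∘ closure⁻ ; trans = closure-trans }
    where
    go : ∀ k {x y} → T (reach r k x y) → closure r ⊢ y ∼ x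
    go zero    t rewrite toWitness t = closure-refl
    go (suc k) t with reach-suc⁻ k t
    ... | inj₁ s           = go k s
    ... | inj₂ (_ , s , q) = closure-trans (closure-incl (r-sym _ _ q)) (go k s)

open Reach using (closure-incl; closure-least; closure-valid)

-- Joins and meets

⊑-⊔ˡ : (P Q : Part n) → P ⊑ P ⊔ Q
⊑-⊔ˡ P Q p = closure-incl _ (from T-∨ (inj₁ (holds p)))

⊑-⊔ʳ : (P Q : Part n) → Q ⊑ P ⊔ Q
⊑-⊔ʳ P Q {x} {y} q = closure-incl _ (from (T-∨ {rel P x y}) (inj₂ (holds q)))

⊔-least : {P Q R : Part n} → Valid R → P ⊑ R → Q ⊑ R → P ⊔ Q ⊑ R
⊔-least v p q = closure-least _ v λ t → [ (λ s → p ⟨ s ⟩) , (λ s → q ⟨ s ⟩) ]′ (to T-∨ t)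

⊔-valid : {P Q : Part n} → Valid P → Valid Q → Valid (P ⊔ Q)
⊔-valid {P = P} {Q} v w = closure-valid _ λ x y t → from (T-∨ {rel P y x})
  ([ (λ s → inj₁ (holds (∼-sym v ⟨ s ⟩))) , (λ s → inj₂ (holds (∼-sym w ⟨ s ⟩))) ]′ (to T-∨ t))

⋁ : Part n → List (Part n) → Part n
⋁ = foldr _⊔_

⊑-⋁ : ∀ (z : Part n) S → z ⊑ ⋁ z S
⊑-⋁ z []      = id
⊑-⋁ z (s ∷ S) = ⊑-⊔ʳ s (⋁ z S) ∘ ⊑-⋁ z S

∈⇒⊑-⋁ : ∀ (z : Part n) {s S} → s ∈ S → s ⊑ ⋁ z S
∈⇒⊑-⋁ z {S = s ∷ S} (here refl) = ⊑-⊔ˡ s (⋁ z S)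
∈⇒⊑-⋁ z {S = s ∷ S} (there m)   = ⊑-⊔ʳ s (⋁ z S) ∘ ∈⇒⊑-⋁ z m

⋁-least : ∀ {z Q : Part n} {S} → Valid Q → z ⊑ Q → (∀ {s} → s ∈ S → s ⊑ Q) → ⋁ z S ⊑ Q
⋁-least {S = []}    v h k = h
⋁-least {S = s ∷ S} v h k = ⊔-least v (k (here refl)) (⋁-least v h (k ∘ there))

⋁-valid : ∀ {z : Part n} {S} → Valid z → All Valid S → Valid (⋁ z S)
⋁-valid v []       = v
⋁-valid v (w ∷ ws) = ⊔-valid w (⋁-valid v ws)

⊓-⊑ : ∀ {K} {P : Part n} → P ∈ K → foldr _⊓_ top K ⊑ P
⊓-⊑ (here refl) p = ⟨ proj₁ (to T-∧ (tabulate⁻ _ p)) ⟩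
⊓-⊑ {K = Q ∷ K} (there m) {x} {y} p = ⊓-⊑ m ⟨ proj₂ (to (T-∧ {rel Q x y}) (tabulate⁻ _ p)) ⟩

⊑-⊓ : ∀ {K} {Q : Part n} → (∀ {P} → P ∈ K → Q ⊑ P) → Q ⊑ foldr _⊓_ top K
⊑-⊓ {K = []} h {x} {y} _ = ⟨ subst T (sym top-rel) _ ⟩
  where
  top-rel : rel top x y ≡ true
  top-rel = trans (cong (λ row → V.lookup row y) (VP.lookup-replicate x _)) (VP.lookup-replicate y true)
⊑-⊓ {K = P ∷ K} h q = tabulate⁺ _ (from T-∧ (holds (h (here refl) q) , holds (⊑-⊓ (h ∘ there) q)))

-- Both `botL` and the bottom element inside `isIrr` are computed as this meet.
⋀-least-element : ∀ {K} {P : Part n} → P ∈ K → (∀ {Q} → Q ∈ K → P ⊑ Q) → foldr _⊓_ top K ≡ P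
⋀-least-element m h = ⊑-antisym (⊓-⊑ m) (⊑-⊓ h)

==P⁺ : {P Q : Part n} → P ≡ Q → T (P ==P Q)
==P⁺ = fromWitness

==P⁻ : {P Q : Part n} → T (P ==P Q) → P ≡ Q
==P⁻ = toWitness

_≟P_ : (P Q : Part n) → Dec (P ≡ Q)
P ≟P Q = map′ ==P⁻ ==P⁺ (T? _)

∈ᵇ⁺ : ∀ {P : Part n} {Qs} → P ∈ Qs → T (P ∈ᵇ Qs)
∈ᵇ⁺ = any⁺ _ ∘ Any.map ==P⁺

∈ᵇ⁻ : ∀ {P : Part n} {Qs} → T (P ∈ᵇ Qs) → P ∈ Qs
∈ᵇ⁻ = Any.map ==P⁻ ∘ any⁻ _ _

-- Merging along edges

Edge : ℕ → Set
Edge n = Fin n × Fin n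

-- With `P` the vertex partition this says that `e` is a loop; with a coarser partition, that `e`
-- becomes a loop after contracting to it.
Linked : Part n → Edge n → Set
Linked P e = P ⊢ proj₁ e ∼ proj₂ e

linked? : ∀ (P : Part n) e → Dec (Linked P e)
linked? P e = P ⊢ proj₁ e ∼? proj₂ e

-- Logical form of `joinsB`. When `x` and `y` are the ends of an edge `f`, it says that `e` and `f`
-- are parallel.
Between : Part n → Edge n → Fin n → Fin n → Set
Between P (a , b) x y = (P ⊢ a ∼ x × P ⊢ b ∼ y) ⊎ (P ⊢ a ∼ y × P ⊢ b ∼ x)

joinsB⁺ : ∀ (P : Part n) e {x y} → Between P e x y → T (joinsB P e x y)
joinsB⁺ P (a , b) {x} {y} (inj₁ (p , q)) = from T-∨ (inj₁ (from T-∧ (holds p , holds q)))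
joinsB⁺ P (a , b) {x} {y} (inj₂ (p , q)) =
  from (T-∨ {rel P a x ∧ rel P b y}) (inj₂ (from T-∧ (holds p , holds q)))

joinsB⁻ : ∀ (P : Part n) e {x y} → T (joinsB P e x y) → Between P e x y
joinsB⁻ P (a , b) {x} {y} t with to (T-∨ {rel P a x ∧ rel P b y}) t
... | inj₁ s = let p , q = to (T-∧ {rel P a x}) s in inj₁ (⟨ p ⟩ , ⟨ q ⟩)
... | inj₂ s = let p , q = to (T-∧ {rel P a y}) s in inj₂ (⟨ p ⟩ , ⟨ q ⟩)

between-swap : ∀ {P : Part n} {e x y} → Between P e x y → Between P e y x
between-swap (inj₁ p) = inj₂ p
between-swap (inj₂ p) = inj₁ p

between-refl : ∀ {P : Part n} {e} → Valid P → Between P e (proj₁ e) (proj₂ e)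
between-refl v = inj₁ (∼-refl v , ∼-refl v)

between-linked : ∀ {P Q : Part n} {e x y} → Valid Q → P ⊑ Q → Between P e x y → Linked Q e → Q ⊢ x ∼ y
between-linked v h (inj₁ (p , q)) l = ∼-trans v (∼-sym v (h p)) (∼-trans v l (h q))
between-linked v h (inj₂ (p , q)) l = ∼-trans v (∼-sym v (h q)) (∼-trans v (∼-sym v l) (h p))

between-linked⁻ : ∀ {P Q : Part n} {e x y} → Valid Q → P ⊑ Q → Between P e x y → Q ⊢ x ∼ y → Linked Q e
between-linked⁻ v h (inj₁ (p , q)) l = ∼-trans v (h p) (∼-trans v l (∼-sym v (h q)))
between-linked⁻ v h (inj₂ (p , q)) l = ∼-trans v (h p) (∼-trans v (∼-sym v l) (∼-sym v (h q)))

between-trans : ∀ {P : Part n} {e f x y} → Valid P →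
                Between P e (proj₁ f) (proj₂ f) → Between P f x y → Between P e x y
between-trans v (inj₁ (p , q)) (inj₁ (r , s)) = inj₁ (∼-trans v p r , ∼-trans v q s)
between-trans v (inj₁ (p , q)) (inj₂ (r , s)) = inj₂ (∼-trans v p r , ∼-trans v q s)
between-trans v (inj₂ (p , q)) (inj₁ (r , s)) = inj₂ (∼-trans v p s , ∼-trans v q r)
between-trans v (inj₂ (p , q)) (inj₂ (r , s)) = inj₁ (∼-trans v p s , ∼-trans v q r)

between-sym : ∀ {P : Part n} {e f} → Valid P →
              Between P e (proj₁ f) (proj₂ f) → Between P f (proj₁ e) (proj₂ e)
between-sym v (inj₁ (p , q)) = inj₁ (∼-sym v p , ∼-sym v q)
between-sym v (inj₂ (p , q)) = inj₂ (∼-sym v q , ∼-sym v p)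

piOf-rel : Part n → List (Edge n) → Fin n → Fin n → Bool
piOf-rel P A x y = rel P x y ∨ any (λ e → joinsB P e x y) A

piOf-rel⁺ : ∀ (P : Part n) A x y → P ⊢ x ∼ y ⊎ (∃ λ e → e ∈ A × Between P e x y) → T (piOf-rel P A x y)
piOf-rel⁺ P A x y (inj₁ p)             = from T-∨ (inj₁ (holds p))
piOf-rel⁺ P A x y (inj₂ (e , e∈A , b)) =
  from (T-∨ {rel P x y}) (inj₂ (any⁺ (λ e → joinsB P e x y) (lose e∈A (joinsB⁺ P e b))))

piOf-rel⁻ : ∀ (P : Part n) A x y → T (piOf-rel P A x y) → P ⊢ x ∼ y ⊎ (∃ λ e → e ∈ A × Between P e x y)
piOf-rel⁻ P A x y t with to (T-∨ {rel P x y}) t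
... | inj₁ s = inj₁ ⟨ s ⟩
... | inj₂ s with find (any⁻ (λ e → joinsB P e x y) A s)
...   | e , e∈A , b = inj₂ (e , e∈A , joinsB⁻ P e b)

⊑-piOf : ∀ (P : Part n) A → P ⊑ piOf P A
⊑-piOf P A {x} {y} p = closure-incl _ (piOf-rel⁺ P A x y (inj₁ p))

piOf-linked : ∀ {P : Part n} {A e} → Valid P → e ∈ A → Linked (piOf P A) e
piOf-linked {P = P} {A} {e} v m =
  closure-incl _ (piOf-rel⁺ P A (proj₁ e) (proj₂ e) (inj₂ (e , m , between-refl {P = P} v)))

piOf-least : ∀ {P Q : Part n} {A} → Valid Q → P ⊑ Q → (∀ {e} → e ∈ A → Linked Q e) → piOf P A ⊑ Q
piOf-least {P = P} {Q} {A} v h k = closure-least _ v λ {x} {y} t → case (piOf-rel⁻ P A x y t)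
  where
  case : ∀ {x y} → P ⊢ x ∼ y ⊎ (∃ λ e → e ∈ A × Between P e x y) → Q ⊢ x ∼ y
  case (inj₁ p)             = h p
  case (inj₂ (e , e∈A , b)) = between-linked v h b (k e∈A)

piOf-valid : ∀ {P : Part n} {A} → Valid P → Valid (piOf P A)
piOf-valid {P = P} {A} v = closure-valid _ λ x y t → piOf-rel⁺ P A y x (swap (piOf-rel⁻ P A x y t))
  where
  swap : ∀ {x y} → P ⊢ x ∼ y ⊎ (∃ λ e → e ∈ A × Between P e x y) →
         P ⊢ y ∼ x ⊎ (∃ λ e → e ∈ A × Between P e y x)
  swap (inj₁ p)             = inj₁ (∼-sym v p)
  swap (inj₂ (e , e∈A , b)) = inj₂ (e , e∈A , between-swap b)

atom : Part n → Edge n → Part n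
atom P e = piOf P (e ∷ [])

atom-linked : ∀ {P : Part n} {e} → Valid P → Linked (atom P e) e
atom-linked {e = e} v = piOf-linked {A = e ∷ []} v (here refl)

atom-least : ∀ {P Q : Part n} {e} → Valid Q → P ⊑ Q → Linked Q e → atom P e ⊑ Q
atom-least {P = P} {Q} {e} v h l = piOf-least {A = e ∷ []} v h linked
  where
  linked : ∀ {f} → f ∈ e ∷ [] → Linked Q f
  linked (here refl) = l

⊑-atom : ∀ (P : Part n) e → P ⊑ atom P e
⊑-atom P e = ⊑-piOf P (e ∷ [])

atom-valid : ∀ {P : Part n} {e} → Valid P → Valid (atom P e)
atom-valid {e = e} v = piOf-valid {A = e ∷ []} v

atom-loop : ∀ {P : Part n} {e} → Valid P → Linked P e → atom P e ≡ P
atom-loop {P = P} {e} v l = ⊑-antisym (atom-least v id l) (⊑-atom P e)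

eqF-pair⁺ : ∀ {x a y b : Fin n} → x ≡ a × y ≡ b → T (eqF x a ∧ eqF y b)
eqF-pair⁺ {x = x} {a} {y} {b} (p , q) = from (T-∧ {eqF x a} {eqF y b}) (fromWitness p , fromWitness q)

eqF-pair⁻ : ∀ {x a y b : Fin n} → T (eqF x a ∧ eqF y b) → x ≡ a × y ≡ b
eqF-pair⁻ {x = x} {a} {y} {b} t with to (T-∧ {eqF x a} {eqF y b}) t
... | p , q = toWitness p , toWitness q

merge⁻ : ∀ (P : Part n) a b x y → T (rel P x y ∨ (eqF x a ∧ eqF y b) ∨ (eqF x b ∧ eqF y a)) →
         P ⊢ x ∼ y ⊎ (x ≡ a × y ≡ b) ⊎ (x ≡ b × y ≡ a)
merge⁻ P a b x y t with to (T-∨ {rel P x y}) t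
... | inj₁ s = inj₁ ⟨ s ⟩
... | inj₂ s with to (T-∨ {eqF x a ∧ eqF y b}) s
...   | inj₁ q = inj₂ (inj₁ (eqF-pair⁻ q))
...   | inj₂ q = inj₂ (inj₂ (eqF-pair⁻ q))

merge⁺ : ∀ (P : Part n) a b x y → P ⊢ x ∼ y ⊎ (x ≡ a × y ≡ b) ⊎ (x ≡ b × y ≡ a) →
         T (rel P x y ∨ (eqF x a ∧ eqF y b) ∨ (eqF x b ∧ eqF y a))
merge⁺ P a b x y (inj₁ p)        = from T-∨ (inj₁ (holds p))
merge⁺ P a b x y (inj₂ (inj₁ p)) = from (T-∨ {rel P x y}) (inj₂ (from T-∨ (inj₁ (eqF-pair⁺ p))))
merge⁺ P a b x y (inj₂ (inj₂ p)) =
  from (T-∨ {rel P x y}) (inj₂ (from (T-∨ {eqF x a ∧ eqF y b}) (inj₂ (eqF-pair⁺ p))))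

-- `merge` adds the single pair `a`, `b`, while `atom` adds all pairs between their blocks; either
-- way the closure is the least partition above `P` that links `a` and `b`.
merge≡atom : ∀ {P : Part n} {a b} → Valid P → merge P a b ≡ atom P (a , b)
merge≡atom {P = P} {a} {b} v = ⊑-antisym
    (closure-least _ w λ {x} {y} t → upper (merge⁻ P a b x y t))
    (atom-least (closure-valid _ λ x y t → merge⁺ P a b y x (swap (merge⁻ P a b x y t)))
      (λ {x} {y} p → closure-incl _ (merge⁺ P a b x y (inj₁ p)))
      (closure-incl _ (merge⁺ P a b a b (inj₂ (inj₁ (refl , refl))))))
  where
  w : Valid (atom P (a , b))
  w = atom-valid v
  upper : ∀ {x y} → P ⊢ x ∼ y ⊎ (x ≡ a × y ≡ b) ⊎ (x ≡ b × y ≡ a) → atom P (a , b) ⊢ x ∼ y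
  upper (inj₁ p)                    = ⊑-atom P _ p
  upper (inj₂ (inj₁ (refl , refl))) = atom-linked v
  upper (inj₂ (inj₂ (refl , refl))) = ∼-sym w (atom-linked v)
  swap : ∀ {x y} → P ⊢ x ∼ y ⊎ (x ≡ a × y ≡ b) ⊎ (x ≡ b × y ≡ a) →
         P ⊢ y ∼ x ⊎ (y ≡ a × x ≡ b) ⊎ (y ≡ b × x ≡ a)
  swap (inj₁ p)              = inj₁ (∼-sym v p)
  swap (inj₂ (inj₁ (p , q))) = inj₂ (inj₂ (q , p))
  swap (inj₂ (inj₂ (p , q))) = inj₂ (inj₁ (q , p))

-- Merging along `f` touches only the two blocks at its ends: `Near` is an equivalence containing
-- all generating pairs. A newly linked pair thus lies in these two blocks, and not in the same one,
-- since then `P` would link it already. Hence an atom determines its pair of blocks.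
linked-atom : ∀ {P : Part n} {e f} → Valid P → ¬ Linked P e → Linked (atom P f) e →
              Between P f (proj₁ e) (proj₂ e)
linked-atom {n} {P} {e} {f} v ¬l l =
    between (closure-least _ near-equiv (λ {x} {y} t → incl (piOf-rel⁻ P (f ∷ []) x y t)) l)
  where
  OnF : Fin n → Set
  OnF x = P ⊢ proj₁ f ∼ x ⊎ P ⊢ proj₂ f ∼ x
  Near : Fin n → Fin n → Set
  Near x y = P ⊢ x ∼ y ⊎ (OnF x × OnF y)
  move : ∀ {x y} → P ⊢ x ∼ y → OnF x → OnF y
  move p (inj₁ q) = inj₁ (∼-trans v q p)
  move p (inj₂ q) = inj₂ (∼-trans v q p)
  near-equiv : IsEquivalence Near
  near-equiv = record
    { refl  = inj₁ (∼-refl v)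
    ; sym   = λ { (inj₁ p) → inj₁ (∼-sym v p) ; (inj₂ (p , q)) → inj₂ (q , p) }
    ; trans = λ { (inj₁ p) (inj₁ q) → inj₁ (∼-trans v p q)
                ; (inj₁ p) (inj₂ (q , r)) → inj₂ (move (∼-sym v p) q , r)
                ; (inj₂ (p , q)) (inj₁ r) → inj₂ (p , move r q)
                ; (inj₂ (p , _)) (inj₂ (_ , r)) → inj₂ (p , r) }
    }
  incl : ∀ {x y} → P ⊢ x ∼ y ⊎ (∃ λ g → g ∈ f ∷ [] × Between P g x y) → Near x y
  incl (inj₁ p)                              = inj₁ p
  incl (inj₂ (_ , here refl , inj₁ (p , q))) = inj₂ (inj₁ p , inj₂ q)
  incl (inj₂ (_ , here refl , inj₂ (p , q))) = inj₂ (inj₂ q , inj₁ p)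
  between : Near (proj₁ e) (proj₂ e) → Between P f (proj₁ e) (proj₂ e)
  between (inj₁ p)                 = contradiction p ¬l
  between (inj₂ (inj₁ p , inj₁ q)) = contradiction (∼-trans v (∼-sym v p) q) ¬l
  between (inj₂ (inj₁ p , inj₂ q)) = inj₁ (p , q)
  between (inj₂ (inj₂ p , inj₁ q)) = inj₂ (q , p)
  between (inj₂ (inj₂ p , inj₂ q)) = contradiction (∼-trans v (∼-sym v p) q) ¬l

-- Generator enriched lattices represented by graphs

Atom : LGraph n → Part n → Set
Atom Γ x = ∃ λ e → e ∈ edges Γ × ¬ Linked (verts Γ) e × x ≡ atom (verts Γ) e

-- Phrased by joins of atoms instead of `piOf`, because `angle` produces its elements as joins of
-- generators. The empty list gives the bottom.
Flat : LGraph n → Part n → Set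
Flat Γ x = ∃ λ S → All (Atom Γ) S × x ≡ ⋁ (verts Γ) S

-- The invariant of both inductions on derivations. Stated by membership, it is blind to order and
-- repetition in the lists, to loops and to parallel copies.
record _Represents_ {n} (M : GEL n) (Γ : LGraph n) : Set where
  field
    gens⇔    : ∀ {x} → x ∈ gens M ⇔ Atom Γ x
    carrier⇔ : ∀ {x} → x ∈ carrier M ⇔ Flat Γ x
open _Represents_

⋁-cong : ∀ {z : Part n} {S S′} → Valid z → All Valid S → All Valid S′ →
         (∀ {s} → s ∈ S → s ∈ S′) → (∀ {s} → s ∈ S′ → s ∈ S) → ⋁ z S ≡ ⋁ z S′
⋁-cong {z = z} {S} {S′} v w w′ f g = ⊑-antisym
  (⋁-least (⋁-valid v w′) (⊑-⋁ z S′) (∈⇒⊑-⋁ z ∘ f))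
  (⋁-least (⋁-valid v w) (⊑-⋁ z S) (∈⇒⊑-⋁ z ∘ g))

module _ {n} {Γ : LGraph n} (v : Valid (verts Γ)) where

  private
    P : Part n
    P = verts Γ

  Atom-valid : ∀ {x} → Atom Γ x → Valid x
  Atom-valid (e , _ , _ , refl) = atom-valid v

  ⊑-Atom : ∀ {x} → Atom Γ x → P ⊑ x
  ⊑-Atom (e , _ , _ , refl) = ⊑-atom P e

  ⋁Atoms-valid : ∀ {S} → All (Atom Γ) S → Valid (⋁ P S)
  ⋁Atoms-valid as = ⋁-valid v (All.map Atom-valid as)

  ⊑-Flat : ∀ {x} → Flat Γ x → P ⊑ x
  ⊑-Flat (S , as , refl) = ⊑-⋁ P S

  verts-Flat : Flat Γ P
  verts-Flat = [] , [] , refl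

  Atom⇒Flat : ∀ {x} → Atom Γ x → Flat Γ x
  Atom⇒Flat {x} a = x ∷ [] , a ∷ [] ,
    ⊑-antisym (⊑-⊔ˡ x P) (⊔-least (Atom-valid a) id (⊑-Atom a))

  -- `neJoin` starts from the first member, `⋁ P` from the bottom; every atom lies above `P`, so the
  -- results agree.
  neJoin-⋁ : ∀ {s S} → All (Atom Γ) (s ∷ S) → ⋁ s S ≡ ⋁ P (s ∷ S)
  neJoin-⋁ {s} {S} (a ∷ as) = ⊑-antisym
    (⋁-least (⋁Atoms-valid (a ∷ as)) (∈⇒⊑-⋁ P {S = s ∷ S} (here refl)) (λ m → ∈⇒⊑-⋁ P {S = s ∷ S} (there m)))
    (⋁-least (⋁-valid (Atom-valid a) (All.map Atom-valid as)) (⊑-⋁ s S ∘ ⊑-Atom a) upper)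
    where
    upper : ∀ {t} → t ∈ s ∷ S → t ⊑ ⋁ s S
    upper (here refl) = ⊑-⋁ s S
    upper (there m)   = ∈⇒⊑-⋁ s m

  -- Every lattice operation ends in `angle`, so from here on only generators have to be compared
  -- with atoms.
  angle-represents : ∀ {H} → (∀ {x} → x ∈ H ⇔ Atom Γ x) → angle H P Represents Γ
  angle-represents {H} h = record { gens⇔ = h ; carrier⇔ = mk⇔ fwd bwd }
    where
    fwd : ∀ {x} → x ∈ carrier (angle H P) → Flat Γ x
    fwd (here refl) = verts-Flat
    fwd (there m) with find (∈-concatMap⁻ neJoin {xs = subs H} m)
    ... | s ∷ S , sS∈ , here refl = s ∷ S , as , neJoin-⋁ as
      where
      as : All (Atom Γ) (s ∷ S)
      as = All.tabulate λ t∈ → to h (Sublist.lookup (∈-subs⁻ H sS∈) t∈)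

    ⋁-carrier : ∀ S → S ∈ subs H → All (Atom Γ) S → ⋁ P S ∈ carrier (angle H P)
    ⋁-carrier []      m as = here refl
    ⋁-carrier (s ∷ S) m as = there (∈-concatMap⁺ neJoin (lose m (here (sym (neJoin-⋁ as)))))

    bwd : ∀ {x} → Flat Γ x → x ∈ carrier (angle H P)
    bwd (S , as , refl) = subst (_∈ carrier (angle H P)) (sym S≡S′)
        (⋁-carrier S′ (∈-subs⁺ (filter-⊆ (T? ∘ (_∈ᵇ S)) H)) as′)
      where
      -- `S` may list its atoms in any order and repeatedly, but `subs H` contains only sublists of
      -- `H`; `S′` is the sublist with the same members.
      S′ : List (Part n)
      S′ = filterᵇ (_∈ᵇ S) H
      S′⇒S : ∀ {s} → s ∈ S′ → s ∈ S
      S′⇒S m = ∈ᵇ⁻ (proj₂ (∈-filterᵇ⁻ (_∈ᵇ S) {xs = H} m))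
      as′ : All (Atom Γ) S′
      as′ = All.tabulate λ m → All.lookup as (S′⇒S m)
      S≡S′ : ⋁ P S ≡ ⋁ P S′
      S≡S′ = ⋁-cong v (All.map Atom-valid as) (All.map Atom-valid as′)
        (λ m → ∈-filterᵇ⁺ (_∈ᵇ S) (from h (All.lookup as m)) (∈ᵇ⁺ m)) S′⇒S

  -- Loops in `A` link nothing new, so the atoms of the non-loops already have `piOf P A` as their
  -- join.
  piOf⇒Flat : ∀ {A} → A ⊆ edges Γ → Flat Γ (piOf P A)
  piOf⇒Flat {A} A⊆ = map (atom P) A′ , All.tabulate isAtom , ⊑-antisym
      (piOf-least {A = A} (⋁Atoms-valid (All.tabulate isAtom)) (⊑-⋁ P (map (atom P) A′)) linked)
      (⋁-least (piOf-valid {A = A} v) (⊑-piOf P A) below)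
    where
    nonloop? : ∀ e → Dec (¬ Linked P e)
    nonloop? e = ¬? (linked? P e)
    A′ : List (Edge n)
    A′ = filter nonloop? A
    isAtom : ∀ {s} → s ∈ map (atom P) A′ → Atom Γ s
    isAtom m with ∈-map⁻ (atom P) m
    ... | e , e∈A′ , eq with ∈-filter⁻ nonloop? {xs = A} e∈A′
    ...   | e∈A , ¬l = e , Sublist.lookup A⊆ e∈A , ¬l , eq
    linked : ∀ {e} → e ∈ A → Linked (⋁ P (map (atom P) A′)) e
    linked {e} e∈A with linked? P e
    ... | yes l = ⊑-⋁ P (map (atom P) A′) l
    ... | no ¬l = ∈⇒⊑-⋁ P (∈-map⁺ (atom P) (∈-filter⁺ nonloop? e∈A ¬l)) (atom-linked v)
    below : ∀ {s} → s ∈ map (atom P) A′ → s ⊑ piOf P A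
    below m with ∈-map⁻ (atom P) m
    ... | e , e∈A′ , refl =
      atom-least (piOf-valid {A = A} v) (⊑-piOf P A) (piOf-linked v (proj₁ (∈-filter⁻ nonloop? {xs = A} e∈A′)))

  -- Taking all edges whose atom occurs in `S`, parallel copies included, gives a sublist of the
  -- edges with no choice of representatives.
  Flat⇒piOf : ∀ {x} → Flat Γ x → ∃ λ A → A ⊆ edges Γ × x ≡ piOf P A
  Flat⇒piOf (S , as , refl) = A , filter-⊆ (T? ∘ inS) (edges Γ) , ⊑-antisym
      (⋁-least (piOf-valid {A = A} v) (⊑-piOf P A) below)
      (piOf-least {A = A} (⋁Atoms-valid as) (⊑-⋁ P S)
        λ m → ∈⇒⊑-⋁ P {S = S} (∈ᵇ⁻ (proj₂ (∈-filterᵇ⁻ inS {xs = edges Γ} m))) (atom-linked v))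
    where
    inS : Edge n → Bool
    inS e = atom P e ∈ᵇ S
    A : List (Edge n)
    A = filterᵇ inS (edges Γ)
    below : ∀ {s} → s ∈ S → s ⊑ piOf P A
    below s∈S with All.lookup as s∈S
    ... | e , e∈ , _ , refl = atom-least (piOf-valid {A = A} v) (⊑-piOf P A)
      (piOf-linked v (∈-filterᵇ⁺ inS e∈ (∈ᵇ⁺ s∈S)))

  flats⇔Flat : ∀ {x} → x ∈ flats Γ ⇔ Flat Γ x
  flats⇔Flat = mk⇔ fwd bwd
    where
    fwd : ∀ {x} → x ∈ flats Γ → Flat Γ x
    fwd m with ∈-map⁻ (piOf P) m
    ... | A , A∈ , refl = piOf⇒Flat (∈-subs⁻ (edges Γ) A∈)
    bwd : ∀ {x} → Flat Γ x → x ∈ flats Γ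
    bwd f with Flat⇒piOf f
    ... | A , A⊆ , refl = ∈-map⁺ (piOf P) (∈-subs⁺ A⊆)

  -- Atoms cover the bottom: a nonempty join contains the atom of some non-loop `f`, and `f`, linked
  -- by `atom P e`, is parallel to `e` by `linked-atom`. So the join links `e` as well.
  Flat-below-atom : ∀ {a e} → Flat Γ a → a ⊑ atom P e → a ≡ P ⊎ a ≡ atom P e
  Flat-below-atom ([] , [] , refl) _ = inj₁ refl
  Flat-below-atom {e = e} (s ∷ S , (f , _ , ¬l , refl) ∷ as , refl) le =
      inj₂ (⊑-antisym le (atom-least valid (⊑-⋁ P (s ∷ S)) e-linked))
    where
    valid : Valid (⋁ P (s ∷ S))
    valid = ⊔-valid (atom-valid v) (⋁Atoms-valid as)
    f-linked : Linked (⋁ P (s ∷ S)) f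
    f-linked = ⊑-⊔ˡ s (⋁ P S) (atom-linked v)
    e-linked : Linked (⋁ P (s ∷ S)) e
    e-linked = between-linked⁻ valid (⊑-⋁ P (s ∷ S)) (linked-atom {f = e} v ¬l (le f-linked)) f-linked

  ⋀Flat : ∀ {K} → (∀ {x} → x ∈ K ⇔ Flat Γ x) → foldr _⊓_ top K ≡ P
  ⋀Flat h = ⋀-least-element (from h verts-Flat) (⊑-Flat ∘ to h)

-- Join irreducible flats

JoinIrreducible : List (Part n) → Part n → Set
JoinIrreducible K x = x ≢ foldr _⊓_ top K × (∀ {a b} → a ∈ K → b ∈ K → a ⊔ b ≡ x → a ≡ x ⊎ b ≡ x)

isIrr⁻ : ∀ (K : List (Part n)) {x} → T (isIrr K x) → JoinIrreducible K x
isIrr⁻ K {x} t with to (T-∧ {not (x ==P foldr _⊓_ top K)}) t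
... | p , q = T-not⁻ p ∘ ==P⁺ , λ {a} {b} a∈ b∈ eq →
    split a b eq (All.lookup (all⁺ _ K (All.lookup (all⁺ _ K q) a∈)) b∈)
  where
  split : ∀ a b → a ⊔ b ≡ x → T (not ((a ⊔ b) ==P x) ∨ (a ==P x) ∨ (b ==P x)) → a ≡ x ⊎ b ≡ x
  split a b eq s with to (T-∨ {not ((a ⊔ b) ==P x)}) s
  ... | inj₁ ¬eq = contradiction (==P⁺ eq) (T-not⁻ ¬eq)
  ... | inj₂ u with to (T-∨ {a ==P x}) u
  ...   | inj₁ w = inj₁ (==P⁻ w)
  ...   | inj₂ w = inj₂ (==P⁻ w)

isIrr⁺ : ∀ (K : List (Part n)) {x} → JoinIrreducible K x → T (isIrr K x)
isIrr⁺ K {x} (p , q) = from T-∧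
    ( T-not⁺ (p ∘ ==P⁻)
    , all⁻ _ (All.tabulate λ {a} a∈ → all⁻ _ (All.tabulate λ {b} b∈ → choose a b (q a∈ b∈))))
  where
  choose : ∀ a b → (a ⊔ b ≡ x → a ≡ x ⊎ b ≡ x) → T (not ((a ⊔ b) ==P x) ∨ (a ==P x) ∨ (b ==P x))
  choose a b h with (a ⊔ b) ≟P x
  ... | no ¬eq = from T-∨ (inj₁ (T-not⁺ (¬eq ∘ ==P⁻)))
  ... | yes eq = from (T-∨ {not ((a ⊔ b) ==P x)}) (inj₂ (from (T-∨ {a ==P x})
          ([ inj₁ ∘ ==P⁺ , inj₂ ∘ ==P⁺ ]′ (h eq))))

Lat-represents : ∀ (Γ : LGraph n) → Valid (verts Γ) → Lat Γ Represents Γ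
Lat-represents {n} Γ v = record { gens⇔ = mk⇔ fwd bwd ; carrier⇔ = K⇔ }
  where
  P : Part n
  P = verts Γ
  K : List (Part n)
  K = flats Γ
  K⇔ : ∀ {x} → x ∈ K ⇔ Flat Γ x
  K⇔ = flats⇔Flat v
  -- Peels atoms off the join: irreducibility makes `x` either the first atom or the join of the
  -- rest, and the empty join is the excluded bottom.
  irreducible⇒Atom : ∀ {x} S → JoinIrreducible K x → All (Atom Γ) S → x ≡ ⋁ P S → Atom Γ x
  irreducible⇒Atom []      (p , _)     []       eq = contradiction (trans eq (sym (⋀Flat v K⇔))) p
  irreducible⇒Atom (s ∷ S) j@(_ , irr) (a ∷ as) eq
    with irr (from K⇔ (Atom⇒Flat v a)) (from K⇔ (S , as , refl)) (sym eq)
  ... | inj₁ s≡x = subst (Atom Γ) s≡x a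
  ... | inj₂ S≡x = irreducible⇒Atom S j as (sym S≡x)
  fwd : ∀ {x} → x ∈ irr K → Atom Γ x
  fwd m with ∈-filterᵇ⁻ (isIrr K) {xs = K} m
  ... | x∈K , t with to K⇔ x∈K
  ...   | S , as , eq = irreducible⇒Atom S (isIrr⁻ K t) as eq
  bwd : ∀ {x} → Atom Γ x → x ∈ irr K
  bwd a@(e , _ , ¬l , refl) =
    ∈-filterᵇ⁺ (isIrr K) (from K⇔ (Atom⇒Flat v a)) (isIrr⁺ K ((λ eq → ¬l (below-P (trans eq (⋀Flat v K⇔)))) , irreducible))
    where
    below-P : atom P e ≡ P → Linked P e
    below-P eq = ≡⇒⊑ eq (atom-linked v)
    irreducible : ∀ {a b} → a ∈ K → b ∈ K → a ⊔ b ≡ atom P e → a ≡ atom P e ⊎ b ≡ atom P e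
    irreducible {a} {b} a∈ b∈ eq
      with Flat-below-atom v (to K⇔ a∈) (≡⇒⊑ eq ∘ ⊑-⊔ˡ a b) | Flat-below-atom v (to K⇔ b∈) (≡⇒⊑ eq ∘ ⊑-⊔ʳ a b)
    ... | inj₂ p    | _         = inj₁ p
    ... | inj₁ _    | inj₂ q    = inj₂ q
    -- If both joinands were the bottom, `P ⊔ P` would link `e`, making it a loop.
    ... | inj₁ refl | inj₁ refl = contradiction (⊔-least v id id (≡⇒⊑ (sym eq) (atom-linked v))) ¬l

represents-unique : ∀ {M N : GEL n} {Γ} → M Represents Γ → N Represents Γ → M ≈L N
represents-unique r s =
    ((λ x → from (carrier⇔ s) ∘ to (carrier⇔ r)) , (λ x → from (carrier⇔ r) ∘ to (carrier⇔ s)))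
  , ((λ x → from (gens⇔ s) ∘ to (gens⇔ r)) , (λ x → from (gens⇔ r) ∘ to (gens⇔ s)))

-- Over a fixed vertex partition the flats are built from the atoms alone; through this lemma loops
-- and parallel edges are discarded.
represents-cong : ∀ {M : GEL n} {P es fs} → (∀ {x} → Atom (lgraph P es) x ⇔ Atom (lgraph P fs) x) →
                  M Represents lgraph P es → M Represents lgraph P fs
represents-cong h r = record
  { gens⇔    = mk⇔ (to h ∘ to (gens⇔ r)) (from (gens⇔ r) ∘ from h)
  ; carrier⇔ = mk⇔
      (λ m → let S , as , eq = to (carrier⇔ r) m in S , All.map (to h) as , eq)
      (λ (S , as , eq) → from (carrier⇔ r) (S , All.map (from h) as , eq))
  }

-- Minors of represented lattices

botL≡verts : ∀ {M : GEL n} {Γ} → Valid (verts Γ) → M Represents Γ → botL M ≡ verts Γ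
botL≡verts v r = ⋀Flat v (carrier⇔ r)

-- `I` and `fs` are tied together only through atoms, so that the lemma serves both directions:
-- `graph-minor` chooses `fs` for a given `I`, `lattice-minor` chooses `I` for a given edge
-- deletion.
deletionL-represents : ∀ {M : GEL n} {P es fs} I → Valid P → M Represents lgraph P es →
                       (∀ {x} → Atom (lgraph P fs) x ⇔ (Atom (lgraph P es) x × x ∉ I)) →
                       deletionL M I Represents lgraph P fs
deletionL-represents {M = M} {P} {es} {fs} I v r h rewrite botL≡verts v r =
    angle-represents v (mk⇔ fwd bwd)
  where
  kept : Part _ → Bool
  kept g = not (g ∈ᵇ I)
  fwd : ∀ {x} → x ∈ filterᵇ kept (gens M) → Atom (lgraph P fs) x
  fwd m with ∈-filterᵇ⁻ kept {xs = gens M} m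
  ... | x∈ , t = from h (to (gens⇔ r) x∈ , λ x∈I → T-not⁻ t (∈ᵇ⁺ x∈I))
  bwd : ∀ {x} → Atom (lgraph P fs) x → x ∈ filterᵇ kept (gens M)
  bwd a with to h a
  ... | a′ , x∉I = ∈-filterᵇ⁺ kept (from (gens⇔ r) a′) (T-not⁺ (x∉I ∘ ∈ᵇ⁻))

-- `atom P e ⊔ i₀` and `atom i₀ e` are both the least partition above `i₀` linking `e`. The whole
-- edge list can stay: the generators absorbed by `i₀` are those whose edges are now loops.
contractionL-represents : ∀ {M : GEL n} {Γ} I → Valid (verts Γ) → M Represents Γ → All (_∈ gens M) I →
                          contractionL M I Represents lgraph (⋁ (verts Γ) I) (edges Γ)
contractionL-represents {n} {M} {Γ} I v r I⊆ rewrite botL≡verts v r =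
    angle-represents w (mk⇔ fwd bwd)
  where
  P i₀ : Part n
  P = verts Γ
  i₀ = ⋁ P I
  w : Valid i₀
  w = ⋁Atoms-valid v (All.map (to (gens⇔ r)) I⊆)
  atom-⊔ : ∀ e → atom P e ⊔ i₀ ≡ atom i₀ e
  atom-⊔ e = ⊑-antisym
    (⊔-least (atom-valid w) (atom-least (atom-valid w) (⊑-atom i₀ e ∘ ⊑-⋁ P I) (atom-linked w)) (⊑-atom i₀ e))
    (atom-least (⊔-valid (atom-valid v) w) (⊑-⊔ʳ (atom P e) i₀) (⊑-⊔ˡ (atom P e) i₀ (atom-linked v)))
  proper : Part n → Bool
  proper g = not (g ==P i₀)
  fwd : ∀ {x} → x ∈ filterᵇ proper (map (_⊔ i₀) (gens M)) → Atom (lgraph i₀ (edges Γ)) x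
  fwd m with ∈-filterᵇ⁻ proper {xs = map (_⊔ i₀) (gens M)} m
  ... | x∈ , t with ∈-map⁻ (_⊔ i₀) x∈
  ...   | g , g∈ , refl with to (gens⇔ r) g∈
  ...     | e , e∈ , _ , refl =
    e , e∈ , (λ l → T-not⁻ t (==P⁺ (trans (atom-⊔ e) (atom-loop w l)))) , atom-⊔ e
  bwd : ∀ {x} → Atom (lgraph i₀ (edges Γ)) x → x ∈ filterᵇ proper (map (_⊔ i₀) (gens M))
  bwd (e , e∈ , ¬l , refl) = ∈-filterᵇ⁺ proper
    (subst (_∈ map (_⊔ i₀) (gens M)) (atom-⊔ e)
      (∈-map⁺ (_⊔ i₀) (from (gens⇔ r) (e , e∈ , ¬l ∘ ⊑-⋁ P I , refl))))
    (T-not⁺ λ t → ¬l (≡⇒⊑ (==P⁻ t) (atom-linked w)))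

-- Minors of graphs

derive-sublist : ∀ {Γ : LGraph n} {P es fs} → Derives Γ (lgraph P es) → fs ⊆ es → Derives Γ (lgraph P fs)
derive-sublist {n} {Γ} {P} = go []
  where
  -- `pre` collects the edges already kept, since a deletion refers to a position in the whole list.
  go : ∀ pre {es fs} → Derives Γ (lgraph P (pre ++ es)) → fs ⊆ es → Derives Γ (lgraph P (pre ++ fs))
  go pre d [] = d
  go pre {y ∷ es} d (y ∷ʳ p) with removeAt-++ pre y es
  ... | i , eq = go pre (subst (Derives Γ ∘ lgraph P) eq (del d i)) p
  go pre {y ∷ es} {y ∷ fs} d (refl ∷ p) =
    subst (Derives Γ ∘ lgraph P) (++-assoc pre (y ∷ []) fs)
      (go (pre ++ y ∷ []) (subst (Derives Γ ∘ lgraph P) (sym (++-assoc pre (y ∷ []) es)) d) p)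

-- One formula covers both branches, because the atom of a loop is the vertex partition itself.
contractE≡ : ∀ (Γ : LGraph n) i → Valid (verts Γ) →
             contractE Γ i ≡ lgraph (atom (verts Γ) (lookup (edges Γ) i)) (removeAt (edges Γ) i)
contractE≡ Γ i v with lookup (edges Γ) i
... | (a , b) = cong (λ P → lgraph P (removeAt (edges Γ) i)) merged
  where
  merged : (if rel (verts Γ) a b then verts Γ else merge (verts Γ) a b) ≡ atom (verts Γ) (a , b)
  merged with rel (verts Γ) a b in eq
  ... | true  = sym (atom-loop v ⟨ from T-≡ eq ⟩)
  ... | false = merge≡atom v

Derives-valid : ∀ {Γ Δ : LGraph n} → Valid (verts Γ) → Derives Γ Δ → Valid (verts Δ)
Derives-valid v here          = v
Derives-valid v (del d i)     = Derives-valid v d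
Derives-valid v (con {Δ} d i) =
  subst (Valid ∘ verts) (sym (contractE≡ Δ i (Derives-valid v d))) (atom-valid (Derives-valid v d))

∈-removeAt-linked : ∀ {P : Part n} {es} i {e} → Valid P → e ∈ es →
                    e ∈ removeAt es i ⊎ Linked (atom P (lookup es i)) e
∈-removeAt-linked {es = es} i v m with ∈-removeAt es i m
... | inj₁ m′   = inj₁ m′
... | inj₂ refl = inj₂ (atom-linked v)

piOf-[] : ∀ {P : Part n} → Valid P → piOf P [] ≡ P
piOf-[] {P = P} v = ⊑-antisym (piOf-least {A = []} v id λ ()) (⊑-piOf P [])

piOf-∷ : ∀ {P : Part n} e A → Valid P → piOf (atom P e) A ≡ piOf P (e ∷ A)
piOf-∷ {P = P} e A v = ⊑-antisym
    (piOf-least {A = A} w (atom-least w (⊑-piOf P (e ∷ A)) (piOf-linked {A = e ∷ A} v (here refl)))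
      (λ m → piOf-linked {A = e ∷ A} v (there m)))
    (piOf-least {A = e ∷ A} (piOf-valid {A = A} (atom-valid v)) (⊑-piOf (atom P e) A ∘ ⊑-atom P e) linked)
  where
  w : Valid (piOf P (e ∷ A))
  w = piOf-valid {A = e ∷ A} v
  linked : ∀ {f} → f ∈ e ∷ A → Linked (piOf (atom P e) A) f
  linked (here refl) = ⊑-piOf (atom P e) A (atom-linked v)
  linked (there m)   = piOf-linked (atom-valid v) m

-- Edges of es that are missing from fs became loops, so they contribute no atoms.
ContractsTo : LGraph n → List (Edge n) → Part n → Set
ContractsTo Γ es Q = ∃ λ fs → Derives Γ (lgraph Q fs) × fs ⊆ es × (∀ {e} → e ∈ es → e ∈ fs ⊎ Linked Q e)

-- Contracting one edge removes its entry and may turn later members of `A` into loops. The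
-- hypothesis that survives the induction is that each is still present or already linked; in the
-- latter case the step is skipped.
contract-edges : ∀ {Γ : LGraph n} A {P es} → Valid P → Derives Γ (lgraph P es) →
                 (∀ {e} → e ∈ A → e ∈ es ⊎ Linked P e) → ContractsTo Γ es (piOf P A)
contract-edges {Γ = Γ} [] {P} {es} v d h =
  es , subst (λ Q → Derives Γ (lgraph Q es)) (sym (piOf-[] v)) d , ⊆-refl , inj₁
contract-edges {n} {Γ} (e ∷ A) {P} {es} v d h with h (here refl)
... | inj₂ l =
    subst (ContractsTo Γ es)
      (trans (cong (λ Q → piOf Q A) (sym (atom-loop v l))) (piOf-∷ e A v))
      (contract-edges A v d (h ∘ there))
... | inj₁ e∈ =
    subst (ContractsTo Γ es) (piOf-∷ e A v) contracted
  where
  i : Fin (length es)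
  i = Any.index e∈
  e≡ : e ≡ lookup es i
  e≡ = lookup-index e∈
  split : ∀ {f} → f ∈ es → f ∈ removeAt es i ⊎ Linked (atom P e) f
  split {f} m = subst (λ g → f ∈ removeAt es i ⊎ Linked (atom P g) f) (sym e≡) (∈-removeAt-linked i v m)
  d′ : Derives Γ (lgraph (atom P e) (removeAt es i))
  d′ = subst (Derives Γ) (trans (contractE≡ (lgraph P es) i v) (cong (λ g → lgraph (atom P g) (removeAt es i)) (sym e≡))) (con d i)
  h′ : ∀ {f} → f ∈ A → f ∈ removeAt es i ⊎ Linked (atom P e) f
  h′ m with h (there m)
  ... | inj₁ f∈ = split f∈
  ... | inj₂ l  = inj₂ (⊑-atom P e l)
  contracted : ContractsTo Γ es (piOf (atom P e) A)
  contracted with contract-edges A (atom-valid v) d′ h′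
  ... | fs , d″ , fs⊆ , cover = fs , d″ , ⊆-trans fs⊆ (removeAt-⊆ es i) , cover′
    where
    cover′ : ∀ {f} → f ∈ es → f ∈ fs ⊎ Linked (piOf (atom P e) A) f
    cover′ m with split m
    ... | inj₁ m′ = cover m′
    ... | inj₂ l  = inj₂ (⊑-piOf (atom P e) A l)

Atom-cong-loops : ∀ {P : Part n} {es fs} → fs ⊆ es → (∀ {e} → e ∈ es → e ∈ fs ⊎ Linked P e) →
                  ∀ {x} → Atom (lgraph P es) x ⇔ Atom (lgraph P fs) x
Atom-cong-loops {P = P} {es} {fs} fs⊆ cover = mk⇔ fwd (λ (e , e∈ , rest) → e , Sublist.lookup fs⊆ e∈ , rest)
  where
  fwd : ∀ {x} → Atom (lgraph P es) x → Atom (lgraph P fs) x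
  fwd (e , e∈ , ¬l , eq) with cover e∈
  ... | inj₁ e∈fs = e , e∈fs , ¬l , eq
  ... | inj₂ l    = contradiction l ¬l

-- Lattice minors correspond to graph minors

module _ {n} {Γ : LGraph n} (v₀ : Valid (verts Γ)) where

  graph-minor : ∀ {N} → DerivesL (Lat Γ) N → ∃ λ Δ → Derives Γ Δ × N Represents Δ
  graph-minor here = Γ , here , Lat-represents Γ v₀
  graph-minor (del d I I⊆) with graph-minor d
  ... | lgraph P es , d′ , r =
      lgraph P fs , derive-sublist d′ (filter-⊆ (T? ∘ kept) es)
    , deletionL-represents I (Derives-valid v₀ d′) r (mk⇔ fwd bwd)
    where
    -- Parallel edges share one atom, so an atom in `I` takes its whole parallel class with it.
    kept : Edge n → Bool
    kept e = not (atom P e ∈ᵇ I)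
    fs : List (Edge n)
    fs = filterᵇ kept es
    fwd : ∀ {x} → Atom (lgraph P fs) x → Atom (lgraph P es) x × x ∉ I
    fwd (e , e∈ , ¬l , refl) with ∈-filterᵇ⁻ kept {xs = es} e∈
    ... | e∈es , t = (e , e∈es , ¬l , refl) , λ m → T-not⁻ t (∈ᵇ⁺ m)
    bwd : ∀ {x} → Atom (lgraph P es) x × x ∉ I → Atom (lgraph P fs) x
    bwd ((e , e∈ , ¬l , refl) , x∉I) = e , ∈-filterᵇ⁺ kept e∈ (T-not⁺ (x∉I ∘ ∈ᵇ⁻)) , ¬l , refl
  graph-minor (con {N} d I I⊆) with graph-minor d
  -- The join of `I` is a flat, hence `piOf P A` for some edges `A`; contracting these reaches the
  -- vertex partition of the lattice contraction.
  ... | lgraph P es , d′ , r with Flat⇒piOf (Derives-valid v₀ d′) (I , All.map (to (gens⇔ r)) I⊆ , refl)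
  ...   | A , A⊆ , eq with contract-edges A (Derives-valid v₀ d′) d′ (inj₁ ∘ Sublist.lookup A⊆)
  ...     | fs , d″ , fs⊆ , cover = lgraph (piOf P A) fs , d″ , represents-cong (Atom-cong-loops fs⊆ cover)
    (subst (λ Q → contractionL N I Represents lgraph Q es) eq
      (contractionL-represents I (Derives-valid v₀ d′) r I⊆))

  lattice-minor : ∀ {Δ} → Derives Γ Δ → ∃ λ N → DerivesL (Lat Γ) N × N Represents Δ
  lattice-minor here = Lat Γ , here , Lat-represents Γ v₀
  lattice-minor (del {Δ} d i) with lattice-minor d
  ... | N , d′ , r =
      deletionL N I , del d′ I (All.tabulate λ m → proj₁ (∈-filterᵇ⁻ lost {xs = gens N} m))
    , deletionL-represents I v r (mk⇔ fwd bwd)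
    where
    v : Valid (verts Δ)
    v = Derives-valid v₀ d
    r′ : Lat (deleteE Δ i) Represents deleteE Δ i
    r′ = Lat-represents (deleteE Δ i) v
    -- Comparing with the lattice of the smaller graph yields the right `I` in all cases: it is
    -- empty if the deleted edge is a loop or has a parallel copy left.
    lost : Part n → Bool
    lost g = not (g ∈ᵇ gens (Lat (deleteE Δ i)))
    I : List (Part n)
    I = filterᵇ lost (gens N)
    fwd : ∀ {x} → Atom (deleteE Δ i) x → Atom Δ x × x ∉ I
    fwd a@(e , e∈ , rest) = (e , Sublist.lookup (removeAt-⊆ (edges Δ) i) e∈ , rest) ,
      λ m → T-not⁻ (proj₂ (∈-filterᵇ⁻ lost {xs = gens N} m)) (∈ᵇ⁺ (from (gens⇔ r′) a))
    bwd : ∀ {x} → Atom Δ x × x ∉ I → Atom (deleteE Δ i) x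
    bwd {x} (a , x∉I) = to (gens⇔ r′) (∈ᵇ⁻ (decidable-stable (T? (x ∈ᵇ gens (Lat (deleteE Δ i))))
      λ ¬t → x∉I (∈-filterᵇ⁺ lost (from (gens⇔ r) a) (T-not⁺ ¬t))))
  lattice-minor (con {Δ} d i) with lattice-minor d | linked? (verts Δ) (lookup (edges Δ) i)
  -- Contracting a loop changes neither vertices nor atoms, so it corresponds to no lattice step.
  ... | N , d′ , r | yes l = N , d′ , subst (N Represents_) (sym (contractE≡ Δ i v))
      (represents-cong (Atom-cong-loops (removeAt-⊆ (edges Δ) i) (∈-removeAt-linked i v))
        (subst (λ Q → N Represents lgraph Q (edges Δ)) (sym (atom-loop v l)) r))
    where
    v : Valid (verts Δ)
    v = Derives-valid v₀ d
  ... | N , d′ , r | no ¬l = contractionL N I , con d′ I I⊆ , subst (contractionL N I Represents_) (sym (contractE≡ Δ i v))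
      (represents-cong (Atom-cong-loops (removeAt-⊆ (edges Δ) i) (∈-removeAt-linked i v))
        -- The equation taken from `Atom⇒Flat` identifies the join of the one-element list `I` over
        -- the bottom with the atom itself.
        (subst (λ Q → contractionL N I Represents lgraph Q (edges Δ)) (sym (proj₂ (proj₂ (Atom⇒Flat v a))))
          (contractionL-represents I v r I⊆)))
    where
    v : Valid (verts Δ)
    v = Derives-valid v₀ d
    a : Atom Δ (atom (verts Δ) (lookup (edges Δ) i))
    a = lookup (edges Δ) i , ∈-lookup i , ¬l , refl
    I : List (Part n)
    I = atom (verts Δ) (lookup (edges Δ) i) ∷ []
    I⊆ : All (_∈ gens N) I
    I⊆ = from (gens⇔ r) a ∷ []

-- Simple graphs

atom-parallel : ∀ {P : Part n} {e f} → Valid P → Between P f (proj₁ e) (proj₂ e) → atom P e ≡ atom P f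
atom-parallel {P = P} {e} {f} v b = ⊑-antisym
  (atom-least (atom-valid v) (⊑-atom P f) (between-linked (atom-valid v) (⊑-atom P f) b (atom-linked v)))
  (atom-least (atom-valid v) (⊑-atom P e) (between-linked⁻ (atom-valid v) (⊑-atom P e) b (atom-linked v)))

mult>0⁺ : ∀ {Γ : LGraph n} {e} x y → e ∈ edges Γ → Between (verts Γ) e x y → 0 < mult Γ x y
mult>0⁺ {Γ = Γ} {e} x y e∈ b =
  ∈⇒0<length (∈-filterᵇ⁺ (λ e → joinsB (verts Γ) e x y) e∈ (joinsB⁺ (verts Γ) e b))

mult>0⁻ : ∀ {Γ : LGraph n} x y → 0 < mult Γ x y → ∃ λ e → e ∈ edges Γ × Between (verts Γ) e x y
mult>0⁻ {Γ = Γ} x y p with 0<length⇒∃ p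
... | e , m with ∈-filterᵇ⁻ (λ e → joinsB (verts Γ) e x y) {xs = edges Γ} m
...   | e∈ , t = e , e∈ , joinsB⁻ (verts Γ) e t

-- The multiplicity at the ends of `e` is positive, so the other graph has an edge parallel to `e`,
-- and parallel edges have equal atoms.
≈G⇒Atom : ∀ {P : Part n} es fs → Valid P → (∀ x y → mult (lgraph P es) x y ≡ mult (lgraph P fs) x y) →
          ∀ {x} → Atom (lgraph P es) x → Atom (lgraph P fs) x
≈G⇒Atom {P = P} es fs v eq (e , e∈ , ¬l , refl)
  with mult>0⁻ {Γ = lgraph P fs} _ _
         (subst (0 <_) (eq (proj₁ e) (proj₂ e)) (mult>0⁺ {Γ = lgraph P es} _ _ e∈ (between-refl v)))
... | f , f∈ , b = f , f∈ , (λ l → ¬l (between-linked v id b l)) , atom-parallel v b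

≈G-represents : ∀ {M : GEL n} Γ Δ → Valid (verts Γ) → Γ ≈G Δ → M Represents Γ → M Represents Δ
≈G-represents (lgraph P es) (lgraph .P fs) v (refl , eq) =
  represents-cong (mk⇔ (≈G⇒Atom es fs v eq) (≈G⇒Atom fs es v λ x y → sym (eq x y)))

-- Removing loops and parallel edges

Between? : ∀ (P : Part n) e x y → Dec (Between P e x y)
Between? P e x y = map′ (joinsB⁻ P e) (joinsB⁺ P e) (T? _)

simple-∷ : ∀ {P : Part n} {e es} → Valid P → ¬ Linked P e →
           (∀ {f} → f ∈ es → ¬ Between P f (proj₁ e) (proj₂ e)) →
           Simple (lgraph P es) → Simple (lgraph P (e ∷ es))
simple-∷ {P = P} {e} {es} v ¬l ¬par (loopless , mult≤1) = loopless′ , mult≤1′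
  where
  loopless′ : ∀ f → f ∈ e ∷ es → rel P (proj₁ f) (proj₂ f) ≡ false
  loopless′ f (here refl) = to T-not-≡ (T-not⁺ (¬l ∘ ⟨_⟩))
  loopless′ f (there m)   = loopless f m
  mult≤1′ : ∀ x y → mult (lgraph P (e ∷ es)) x y ≤ 1
  mult≤1′ x y with joinsB P e x y in eq
  ... | false = mult≤1 x y
  ... | true  = s≤s (≮⇒≥ others)
    where
    others : ¬ (0 < mult (lgraph P es) x y)
    others p with mult>0⁻ {Γ = lgraph P es} x y p
    -- Reading `(x , y)` as an edge, `f` and `e` are both parallel to it and hence to each other.
    ... | f , f∈ , b = ¬par f∈ (between-trans {e = f} {f = x , y} v b
            (between-sym {e = e} {f = x , y} v (joinsB⁻ P e (from T-≡ eq))))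

-- Greedy from the end of the list: an edge is kept if it is neither a loop nor parallel to one
-- already kept. The covering property ensures that no atom is lost.
simplify : ∀ {P : Part n} → Valid P → ∀ es →
           ∃ λ fs → fs ⊆ es × Simple (lgraph P fs) ×
                    (∀ {e} → e ∈ es → Linked P e ⊎ ∃ λ f → f ∈ fs × Between P f (proj₁ e) (proj₂ e))
simplify v [] = [] , [] , ((λ _ ()) , λ _ _ → z≤n) , λ ()
simplify {n} {P} v (e ∷ es) with simplify v es
... | fs , fs⊆ , simple , cover with linked? P e
...   | yes l = fs , e ∷ʳ fs⊆ , simple , λ { (here refl) → inj₁ l ; (there m) → cover m }
...   | no ¬l with Any.any? (λ f → Between? P f (proj₁ e) (proj₂ e)) fs
...     | yes par = fs , e ∷ʳ fs⊆ , simple , λ { (here refl) → inj₂ (find par) ; (there m) → cover m }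
...     | no ¬par = e ∷ fs , refl ∷ fs⊆ , simple-∷ v ¬l (λ f∈ b → ¬par (lose f∈ b)) simple , cover′
  where
  cover′ : ∀ {g} → g ∈ e ∷ es → Linked P g ⊎ ∃ λ f → f ∈ e ∷ fs × Between P f (proj₁ g) (proj₂ g)
  cover′ (here refl) = inj₂ (e , here refl , between-refl v)
  cover′ (there m) with cover m
  ... | inj₁ l             = inj₁ l
  ... | inj₂ (f , f∈ , b) = inj₂ (f , there f∈ , b)

Atom-cong-simplify : ∀ {P : Part n} {es fs} → Valid P → fs ⊆ es →
  (∀ {e} → e ∈ es → Linked P e ⊎ ∃ λ f → f ∈ fs × Between P f (proj₁ e) (proj₂ e)) →
  ∀ {x} → Atom (lgraph P es) x ⇔ Atom (lgraph P fs) x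
Atom-cong-simplify {P = P} {es} {fs} v fs⊆ cover =
    mk⇔ fwd (λ (e , e∈ , rest) → e , Sublist.lookup fs⊆ e∈ , rest)
  where
  fwd : ∀ {x} → Atom (lgraph P es) x → Atom (lgraph P fs) x
  fwd (e , e∈ , ¬l , refl) with cover e∈
  ... | inj₁ l            = contradiction l ¬l
  ... | inj₂ (f , f∈ , b) = f , f∈ , (λ l → ¬l (between-linked v id b l)) , atom-parallel v b

-- Recovering a simple graph from its lattice

simple-nonloop : ∀ {Γ : LGraph n} {e} → Simple Γ → e ∈ edges Γ → ¬ Linked (verts Γ) e
simple-nonloop (loopless , _) e∈ l = subst T (loopless _ e∈) (holds l)

-- Simplicity makes `e` a non-loop, so it has an atom; an edge `f` of the other graph with this atom
-- links `e`, and by `linked-atom` it joins the same two blocks.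
Atom⇒mult : ∀ {P : Part n} es fs → Valid P → Simple (lgraph P es) →
            (∀ {x} → Atom (lgraph P es) x → Atom (lgraph P fs) x) →
            ∀ x y → 0 < mult (lgraph P es) x y → 0 < mult (lgraph P fs) x y
Atom⇒mult {P = P} es fs v simple h x y p with mult>0⁻ {Γ = lgraph P es} x y p
... | e , e∈ , b with h (e , e∈ , simple-nonloop simple e∈ , refl)
...   | f , f∈ , _ , eq = mult>0⁺ {Γ = lgraph P fs} x y f∈ (between-trans {e = f} {f = e} v
          (linked-atom {e = e} {f} v (simple-nonloop simple e∈) (≡⇒⊑ eq (atom-linked v))) b)

Lat-injective : ∀ (Γ Δ : LGraph n) → Valid (verts Γ) → Valid (verts Δ) → Simple Γ → Simple Δ →
                Lat Γ ≈L Lat Δ → Γ ≈G Δ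
Lat-injective {n} Γ@(lgraph P es) Δ@(lgraph Q fs) v w s t ((c⇒ , c⇐) , (g⇒ , g⇐)) =
    -- Each vertex partition is the least element of the common carrier, so the two coincide.
    same (⊑-antisym (⊑-Flat {Γ = Γ} v (to (carrier⇔ r) (c⇐ Q (from (carrier⇔ r′) (verts-Flat {Γ = Δ} w)))))
                    (⊑-Flat {Γ = Δ} w (to (carrier⇔ r′) (c⇒ P (from (carrier⇔ r) (verts-Flat {Γ = Γ} v))))))
         (λ {z} a → to (gens⇔ r′) (g⇒ z (from (gens⇔ r) a)))
         (λ {z} a → to (gens⇔ r) (g⇐ z (from (gens⇔ r′) a)))
  where
  r : Lat Γ Represents Γ
  r = Lat-represents Γ v
  r′ : Lat Δ Represents Δ
  r′ = Lat-represents Δ w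
  -- The equation is an argument so that matching on `refl` places both graphs on one vertex
  -- partition before multiplicities are compared.
  same : P ≡ Q → (∀ {z} → Atom Γ z → Atom Δ z) → (∀ {z} → Atom Δ z → Atom Γ z) → Γ ≈G Δ
  same refl f g = refl , λ x y → ≤1-ext (proj₂ s x y) (proj₂ t x y)
    (Atom⇒mult es fs v s f x y) (Atom⇒mult fs es w t g x y)

-- The bijection

VLMinor-valid : ∀ {Γ H : LGraph n} → Valid (verts Γ) → VLMinor Γ H → Valid (verts H)
VLMinor-valid v (Δ , d , eq , _) = subst Valid eq (Derives-valid v d)

≈L-trans : ∀ {L M N : GEL n} → L ≈L M → M ≈L N → L ≈L N
≈L-trans ((a , b) , (c , d)) ((a′ , b′) , (c′ , d′)) =
    ((λ x → a′ x ∘ a x) , (λ x → b x ∘ b′ x)) , ((λ x → c′ x ∘ c x) , (λ x → d x ∘ d′ x))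

mainTheorem10 : (n : ℕ) (E : List (Fin n × Fin n)) →
  -- well defined: L(H) is a minor of L(G), and respects equality of labeled graphs
  ((H : LGraph n) → VLMinor (orig E) H → Simple H → GELMinor (Lat (orig E)) (Lat H))
  × ((H H' : LGraph n) → VLMinor (orig E) H → Simple H → VLMinor (orig E) H' → Simple H' →
       H ≈G H' → Lat H ≈L Lat H')
  -- injective
  × ((H H' : LGraph n) → VLMinor (orig E) H → Simple H → VLMinor (orig E) H' → Simple H' →
       Lat H ≈L Lat H' → H ≈G H')
  -- surjective
  × ((M : GEL n) → GELMinor (Lat (orig E)) M →
       Σ (LGraph n) (λ H → VLMinor (orig E) H × Simple H × (Lat H ≈L M)))
mainTheorem10 n E = minor , respects , injective , surjective
  where
  v₀ : Valid (verts (orig E))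
  v₀ = discrete-valid

  minor : (H : LGraph n) → VLMinor (orig E) H → Simple H → GELMinor (Lat (orig E)) (Lat H)
  minor H m@(Δ , d , Δ≈H) _ with lattice-minor v₀ d
  ... | N , d′ , r = N , d′ , represents-unique
    (≈G-represents Δ H (Derives-valid v₀ d) Δ≈H r) (Lat-represents H (VLMinor-valid {H = H} v₀ m))

  respects : (H H' : LGraph n) → VLMinor (orig E) H → Simple H → VLMinor (orig E) H' → Simple H' →
             H ≈G H' → Lat H ≈L Lat H'
  respects H H' m _ m' _ eq = represents-unique
      (≈G-represents H H' v eq (Lat-represents H v)) (Lat-represents H' (VLMinor-valid {H = H'} v₀ m'))
    where
    v : Valid (verts H)
    v = VLMinor-valid {H = H} v₀ m

  injective : (H H' : LGraph n) → VLMinor (orig E) H → Simple H → VLMinor (orig E) H' → Simple H' →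
              Lat H ≈L Lat H' → H ≈G H'
  injective H H' m s m' s' =
    Lat-injective H H' (VLMinor-valid {H = H} v₀ m) (VLMinor-valid {H = H'} v₀ m') s s'

  surjective : (M : GEL n) → GELMinor (Lat (orig E)) M →
               Σ (LGraph n) (λ H → VLMinor (orig E) H × Simple H × (Lat H ≈L M))
  surjective M (N , d , N≈M) with graph-minor v₀ d
  ... | lgraph P es , d′ , r with simplify (Derives-valid v₀ d′) es
  ...   | fs , fs⊆ , simple , cover =
      -- Simplifying only deletes edges, so the simple graph is again a minor, and it represents the
      -- same lattice.
      lgraph P fs , (lgraph P fs , derive-sublist d′ fs⊆ , refl , λ _ _ → refl) , simple
    , ≈L-trans (represents-unique (Lat-represents (lgraph P fs) v) (represents-cong (Atom-cong-simplify v fs⊆ cover) r)) N≈M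
    where
    v : Valid P
    v = Derives-valid v₀ d′
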